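{- For any distributed Petri net $N$ there is an LSGA net $N'$ with $N'\approx^\Delta_{bSTb}N$.
   Context: **Petri nets.** Let $\mathrm{Act}$ be a set of visible actions, $\tau\notin\mathrm{Act}$ the invisible action, $\mathrm{Act}_\tau=\mathrm{Act}\cup\{\tau\}$. A multiset over $X$ is a function $A:X\to\mathbb N$; $\le,+,-$ are pointwise, $x\in A$ iff $A(x)\neq 0$, $\varnothing$ is the zero multiset, $|A|=\sum_xA(x)$, $A\restriction Y$ is restriction; multisets over different domains are extended by $0$ where needed. Sets are identified with $0/1$-valued multisets. A (labelled) Petri net is $N=(S,T,F,M_0,\ell)$ with $S,T$ disjoint sets (places, transitions), $F:(S\times T\cup T\times S)\to\mathbb N$, initial marking $M_0:S\to\mathbb N$, labelling $\ell:T\to\mathrm{Act}_\tau$. A marking is a multiset $M\in\mathbb N^S$. For $x\in S\cup T$ the multisets ${}^\bullet x,x^\bullet$ are ${}^\bullet x(y)=F(y,x)$, $x^\bullet(y)=F(x,y)$; they extend additively to multisets. For non-empty finite $G\in\mathbb N^T$, $M[G\rangle M'$ iff ${}^\bullet G\le M$ and $M'=(M-{}^\bullet G)+G^\bullet$; $M[G\rangle$ means $\exists M'.\,M[G\rangle M'$; $M[t\rangle M'$ abbreviates $M[\{t\}\rangle M'$. $[M_0\rangle$ is the smallest set of markings containing $M_0$ and closed under steps $[G\rangle$. $t\smile u$ iff $\exists M\in[M_0\rangle.\ M[\{t\}+\{u\}\rangle$ (also for $t=u$). $M\xrightarrow{\alpha}M'$ iff $M[t\rangle M'$ for some $t$ with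 $\ell(t)=\alpha$. **Distributed nets.** $N$ is *distributed* iff there is a function $D$ from $S\cup T$ to some set of locations such that (1) $s\in{}^\bullet t$ implies $D(t)=D(s)$ for $s\in S,t\in T$, and (2) $t\smile u$ implies $D(t)\neq D(u)$ for $t,u\in T$. **LSGA nets.** For a Petri net $N=(S,T,F,M_0,\ell)$ and $I,O\subseteq S$ with $I\cap O=\varnothing$ and $o^\bullet=\varnothing$ for all $o\in O$, the triple $(N,I,O)$ is a *component with interface* $(I,O)$. It is *sequential* iff there is $Q\subseteq S\setminus(I\cup O)$ with $|{}^\bullet t\restriction Q|=1$ and $|t^\bullet\restriction Q|=1$ for all $t\in T$, and $|M_0\restriction Q|=1$. Let $((S_k,T_k,F_k,{M_0}_k,\ell_k),I_k,O_k)$, $k\in\mathfrak K$, be components with interface such that for all $k\ne l$: $(S_k\cup T_k)\cap(S_l\cup T_l)=(I_k\cup O_k)\cap(I_l\cup O_l)$ and $I_k\cap I_l=\varnothing$. Their *asynchronous parallel composition* is $((S,T,F,M_0,\ell),I,O)$ with $S=\bigcup_kS_k$, $T=\bigcup_kT_k$, $F=\bigcup_kF_k$ (value $0$ on pairs not in the domain of any $F_k$), $M_0=\sum_k{M_0}_k$, $\ell=\bigcup_k\ell_k$, $I=\bigcup_kI_k$, $O=\bigcup_kO_k\setminus\bigcup_kI_k$. A Petri net $N$ is an *LSGA net* iff for some $I,O$, $(N,I,O)$ is the asynchronous parallel composition of a family of sequential components with interface (satisfying these conditions). **ST-LTS.** An ST-marking of $N$ is a pair $(M,U)\in\mathbb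 N^S\times T^*$; the initial one is $(M_0,\varepsilon)$. Transitions: $(M,U)\xrightarrow{a^+}(M',U')$ iff there is $t$ with $\ell(t)=a$, $M[t\rangle$, $M'=M-{}^\bullet t$, $U'=Ut$; $(M,U)\xrightarrow{a^{ -n}}(M',U')$ ($a\in\mathrm{Act}$, $n>0$) iff the $n$-th element $t$ of $U$ exists and has $\ell(t)=a$, $U'$ is $U$ with the $n$-th element removed, $M'=M+t^\bullet$; $(M,U)\xrightarrow{\tau}(M',U')$ iff $M\xrightarrow{\tau}M'$ and $U'=U$. The ST-LTS of $N$ has the ST-markings as states. **Branching bisimilarity with explicit divergence.** For labelled transition systems (LTSs), $\Longrightarrow$ is the reflexive transitive closure of $\xrightarrow{\tau}$, and $p\xrightarrow{(\alpha)}p'$ means $p\xrightarrow{\alpha}p'$ or ($\alpha=\tau$ and $p=p'$). A branching bisimulation between two LTSs is a relation $\mathcal B$ between their states such that initial states are related; if $p\,\mathcal B\,q$ and $p\xrightarrow{\alpha}p'$ then $q\Longrightarrow q^\dagger\xrightarrow{(\alpha)}q'$ for some $q^\dagger,q'$ with $p\,\mathcal B\,q^\dagger$, $p'\,\mathcal B\,q'$; and symmetrically. The LTSs are branching bisimilar with explicit divergence iff there is such a $\mathcal B$ satisfying moreover: if $p\,\mathcal B\,q$ and $p=p_0\xrightarrow{\tau}p_1\xrightarrow{\tau}\cdots$ is infinite with $p_k\,\mathcal B\,q$ for all $k$, then there is an infinite $q=q_0\xrightarrow{\tau}q_1\xrightarrow{\tau}\cdots$ with $p_k\,\mathcal B\,q_l$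 for all $k,l$; and symmetrically. $N_1\approx^\Delta_{bSTb}N_2$ iff the ST-LTSs of $N_1,N_2$ are branching bisimilar with explicit divergence. -}

module Defs where

open import Level using (Level; _⊔_) renaming (suc to lsuc)
open import Data.Nat using (ℕ; zero; suc; _+_; _∸_; _≤_)
open import Data.Fin using (Fin; toℕ)
open import Data.List using (List; []; _∷_; _∷ʳ_; map; sum; length; lookup; removeAt)
open import Data.List.NonEmpty using (List⁺; toList) renaming (_∷_ to _∷⁺_)
open import Data.List.Membership.Propositional using () renaming (_∈_ to _∈ˡ_)
open import Data.List.Relation.Unary.All using (All)
open import Data.List.Relation.Unary.Unique.Propositional using (Unique)
open import Data.Product using (Σ; ∃; _×_; _,_; proj₁; proj₂) renaming (map to ×-map)
open import Data.Sum using (_⊎_; inj₁; inj₂) renaming (map to ⊎-map)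
open import Function using (_∘_; flip)
open import Function.Definitions using (Injective)
open import Relation.Binary.Construct.Closure.ReflexiveTransitive using (Star)
open import Relation.Binary.Core using (REL)
open import Relation.Binary.PropositionalEquality using (_≡_; _≢_; _≗_)
open import Relation.Nullary using (¬_)
open import Relation.Unary using (Pred; Empty; _∈_; _⊆_; _≐_; _∪_; _∩_; _∖_; ∁; ⋃)

Multiset : ∀ {ℓ} → Set ℓ → Set ℓ
Multiset X = X → ℕ

module _ {ℓ : Level} {X : Set ℓ} where

  infix 4 _∈ᴹ_ _≤ᴹ_
  infixl 6 _+ᴹ_ _-ᴹ_

  _∈ᴹ_ : X → Multiset X → Set
  x ∈ᴹ A = A x ≢ 0

  _≤ᴹ_ : Multiset X → Multiset X → Set ℓ
  A ≤ᴹ B = ∀ x → A x ≤ B x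

  _+ᴹ_ : Multiset X → Multiset X → Multiset X
  (A +ᴹ B) x = A x + B x

  _-ᴹ_ : Multiset X → Multiset X → Multiset X
  (A -ᴹ B) x = A x ∸ B x

  -- ∣ A ↾ Y ∣≡ n : the sum of A(x) over all x in Y exists and equals n.
  -- X may be infinite; the sum exists iff A has finite support in Y, and
  -- xs enumerates (without repetition) a part of Y containing this support.
  ∣_↾_∣≡_ : Multiset X → Pred X ℓ → ℕ → Set ℓ
  ∣ A ↾ Y ∣≡ n = ∃ λ (xs : List X) →
    Unique xs × All Y xs × (∀ x → x ∈ Y → x ∈ᴹ A → x ∈ˡ xs) × sum (map A xs) ≡ n

image : ∀ {ℓ} {X Y : Set ℓ} → (X → Y) → Pred X ℓ → Pred Y ℓ
image f P y = ∃ λ x → x ∈ P × f x ≡ y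

data _ᵗᵃᵘ {ℓ} (A : Set ℓ) : Set ℓ where
  τ   : A ᵗᵃᵘ
  vis : A → A ᵗᵃᵘ

-- Disjointness of S and T is built in: S ∪ T is the disjoint union S ⊎ T.
record Net {ℓ} (Act : Set ℓ) : Set (lsuc ℓ) where
  field
    S T   : Set ℓ
    F     : (S × T) ⊎ (T × S) → ℕ
    M₀    : Multiset S
    label : T → Act ᵗᵃᵘ

  Marking : Set ℓ
  Marking = Multiset S

  pre post : T → Multiset S
  pre  t s = F (inj₁ (s , t))
  post t s = F (inj₂ (t , s))

  postˢ : S → Multiset T
  postˢ s t = F (inj₁ (s , t))

  -- Non-empty finite multisets of transitions are represented by non-empty
  -- lists; the order of a list is irrelevant to everything defined below.
  pre⁺ post⁺ : List⁺ T → Multiset S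
  pre⁺  G s = sum (map (λ t → pre  t s) (toList G))
  post⁺ G s = sum (map (λ t → post t s) (toList G))

  ⟅_⟆ : T → List⁺ T
  ⟅ t ⟆ = t ∷⁺ []

  ⟅_⟆+⟅_⟆ : T → T → List⁺ T
  ⟅ t ⟆+⟅ u ⟆ = t ∷⁺ (u ∷ [])

  -- Markings are functions and are compared pointwise (≗), as function
  -- extensionality is not available.
  _[_⟩_ : Marking → List⁺ T → Marking → Set ℓ
  M [ G ⟩ M′ = pre⁺ G ≤ᴹ M × M′ ≗ (M -ᴹ pre⁺ G) +ᴹ post⁺ G

  _[_⟩ : Marking → List⁺ T → Set ℓ
  M [ G ⟩ = ∃ λ M′ → M [ G ⟩ M′

  data Reachable : Pred Marking ℓ where
    initial : Reachable M₀
    step    : ∀ {M G M′} → Reachable M → M [ G ⟩ M′ → Reachable M′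

  _⌣_ : T → T → Set ℓ
  t ⌣ u = ∃ λ M → Reachable M × M [ ⟅ t ⟆+⟅ u ⟆ ⟩

  _-[_]→_ : Marking → Act ᵗᵃᵘ → Marking → Set ℓ
  M -[ α ]→ M′ = ∃ λ t → label t ≡ α × M [ ⟅ t ⟆ ⟩ M′

Distributed : ∀ {ℓ} {Act : Set ℓ} → Net Act → Set (lsuc ℓ)
Distributed {ℓ} N =
  Σ (Set ℓ) λ Loc → Σ (S ⊎ T → Loc) λ D →
    (∀ s t → s ∈ᴹ pre t → D (inj₂ t) ≡ D (inj₁ s)) ×
    (∀ t u → t ⌣ u → D (inj₂ t) ≢ D (inj₂ u))
  where
  open Net N

record Component {ℓ} (Act : Set ℓ) : Set (lsuc ℓ) where
  field
    net : Net Act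
  open Net net public
  field
    I O         : Pred S ℓ
    I∩O=∅       : Empty (I ∩ O)
    outputs-end : ∀ o → o ∈ O → postˢ o ≗ (λ _ → 0)

Sequential : ∀ {ℓ} {Act : Set ℓ} → Component Act → Set (lsuc ℓ)
Sequential {ℓ} C = Σ (Pred S ℓ) λ Q →
    Q ⊆ ∁ (I ∪ O) ×
    (∀ t → ∣ pre  t ↾ Q ∣≡ 1) ×
    (∀ t → ∣ post t ↾ Q ∣≡ 1) ×
    ∣ M₀ ↾ Q ∣≡ 1
  where
  open Component C

-- A family of sets S_k with union S is given by types S_k with injections
-- into S (likewise for T); "the set S_k" is the image of its injection, and
-- elements of different components are identified iff their images coincide.
module Composition {ℓ} {Act : Set ℓ} {K : Set ℓ} (C : K → Component Act) (N : Net Act)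
         (place : ∀ k → Component.S (C k) → Net.S N)
         (trans : ∀ k → Component.T (C k) → Net.T N) where

  private
    module C k = Component (C k)
    module N = Net N

  element : ∀ k → C.S k ⊎ C.T k → N.S ⊎ N.T
  element k = ⊎-map (place k) (trans k)

  arc : ∀ k → (C.S k × C.T k) ⊎ (C.T k × C.S k) → (N.S × N.T) ⊎ (N.T × N.S)
  arc k = ⊎-map (×-map (place k) (trans k)) (×-map (trans k) (place k))

  inputs outputs : K → Pred N.S ℓ
  inputs  k = image (place k) (C.I k)
  outputs k = image (place k) (C.O k)

  elements interface : K → Pred (N.S ⊎ N.T) ℓ
  elements  k e = ∃ λ x → element k x ≡ e
  interface k = image inj₁ (inputs k ∪ outputs k)

  record IsComposition (I O : Pred N.S ℓ) : Set (lsuc ℓ) where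
    field
      element-injective : ∀ k → Injective _≡_ _≡_ (element k)

      sharing         : ∀ k l → k ≢ l →
                        elements k ∩ elements l ≐ interface k ∩ interface l
      inputs-disjoint : ∀ k l → k ≢ l → Empty (inputs k ∩ inputs l)

      S=⋃ : ∀ s → ∃ λ k → ∃ λ x → place k x ≡ s
      T=⋃ : ∀ t → ∃ λ k → ∃ λ x → trans k x ≡ t

      F-inside  : ∀ k z → N.F (arc k z) ≡ C.F k z
      F-outside : ∀ z → (∀ k w → arc k w ≢ z) → N.F z ≡ 0

      -- M₀(s) is the sum of (M₀)_k(x) over all k and x in S_k with x = s.
      M₀=Σ : ∀ s →
        ∣ (λ (k , x) → C.M₀ k x) ↾ (λ ((k , x) : Σ K C.S) → place k x ≡ s) ∣≡ N.M₀ s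

      label=⋃ : ∀ k t → N.label (trans k t) ≡ C.label k t

      I=⋃ : I ≐ ⋃ K inputs
      O=⋃ : O ≐ ⋃ K outputs ∖ ⋃ K inputs

IsAsyncParallelComposition : ∀ {ℓ} {Act K : Set ℓ} → (K → Component Act) →
  (N : Net Act) (I O : Pred (Net.S N) ℓ) → Set (lsuc ℓ)
IsAsyncParallelComposition C N I O =
  ∃ λ place → ∃ λ trans → Composition.IsComposition C N place trans I O

LSGA : ∀ {ℓ} {Act : Set ℓ} → Net Act → Set (lsuc ℓ)
LSGA {ℓ} {Act} N =
  Σ (Pred (Net.S N) ℓ) λ I → Σ (Pred (Net.S N) ℓ) λ O →
  Σ (Set ℓ) λ K → Σ (K → Component Act) λ C →
    (∀ k → Sequential (C k)) × IsAsyncParallelComposition C N I O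

record LTS {ℓ} (A : Set ℓ) : Set (lsuc ℓ) where
  field
    State : Set ℓ
    start : State
    _⟶⟨_⟩_ : State → A ᵗᵃᵘ → State → Set ℓ

  _⟹_ : State → State → Set ℓ
  _⟹_ = Star (λ p q → p ⟶⟨ τ ⟩ q)

  _⟶⟨⟨_⟩⟩_ : State → A ᵗᵃᵘ → State → Set ℓ
  p ⟶⟨⟨ α ⟩⟩ p′ = p ⟶⟨ α ⟩ p′ ⊎ (α ≡ τ × p ≡ p′)

  InfiniteτPath : State → (ℕ → State) → Set ℓ
  InfiniteτPath p ps = ps 0 ≡ p × (∀ k → ps k ⟶⟨ τ ⟩ ps (suc k))

module _ {ℓ} {A : Set ℓ} where

  Transfer : (P Q : LTS A) → REL (LTS.State P) (LTS.State Q) ℓ → Set ℓ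
  Transfer P Q B = ∀ {p q α p′} → B p q → p P.⟶⟨ α ⟩ p′ →
    ∃ λ q† → ∃ λ q′ → q Q.⟹ q† × q† Q.⟶⟨⟨ α ⟩⟩ q′ × B p q† × B p′ q′
    where
    module P = LTS P
    module Q = LTS Q

  DivergenceTransfer : (P Q : LTS A) → REL (LTS.State P) (LTS.State Q) ℓ → Set ℓ
  DivergenceTransfer P Q B = ∀ {p q ps} → B p q →
    P.InfiniteτPath p ps → (∀ k → B (ps k) q) →
    ∃ λ qs → Q.InfiniteτPath q qs × (∀ k l → B (ps k) (qs l))
    where
    module P = LTS P
    module Q = LTS Q

  record IsBranchingBisimulation (P Q : LTS A)
           (B : REL (LTS.State P) (LTS.State Q) ℓ) : Set ℓ where
    field
      starts   : B (LTS.start P) (LTS.start Q)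
      forward  : Transfer P Q B
      backward : Transfer Q P (flip B)

  BranchingBisimilarΔ : LTS A → LTS A → Set (lsuc ℓ)
  BranchingBisimilarΔ P Q = Σ (REL (LTS.State P) (LTS.State Q) ℓ) λ B →
    IsBranchingBisimulation P Q B ×
    DivergenceTransfer P Q B × DivergenceTransfer Q P (flip B)

-- a ⁺ is the start of an a; a ⁻[1+ n ] is a⁻⁽ⁿ⁺¹⁾, the end of the action
-- performed by the transition at 0-based position n.
data STLabel {ℓ} (Act : Set ℓ) : Set ℓ where
  _⁺      : Act → STLabel Act
  _⁻[1+_] : Act → ℕ → STLabel Act

module _ {ℓ} {Act : Set ℓ} (N : Net Act) where
  open Net N

  STMarking : Set ℓ
  STMarking = Marking × List T

  STStep : STMarking → STLabel Act ᵗᵃᵘ → STMarking → Set ℓ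
  STStep (M , V) (vis (a ⁺)) (M′ , V′) = ∃ λ t →
    label t ≡ vis a × M [ ⟅ t ⟆ ⟩ × M′ ≗ M -ᴹ pre t × V′ ≡ V ∷ʳ t
  STStep (M , V) (vis (a ⁻[1+ n ])) (M′ , V′) = Σ (Fin (length V)) λ i →
    toℕ i ≡ n × label (lookup V i) ≡ vis a ×
    V′ ≡ removeAt V i × M′ ≗ M +ᴹ post (lookup V i)
  STStep (M , V) τ (M′ , V′) = M -[ τ ]→ M′ × V′ ≡ V

  ST-LTS : LTS (STLabel Act)
  ST-LTS = record { State = STMarking ; start = M₀ , [] ; _⟶⟨_⟩_ = STStep }

infix 4 _≈ᵇˢᵀᵇ_
_≈ᵇˢᵀᵇ_ : ∀ {ℓ} {Act : Set ℓ} → Net Act → Net Act → Set (lsuc ℓ)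
N₁ ≈ᵇˢᵀᵇ N₂ = BranchingBisimilarΔ (ST-LTS N₁) (ST-LTS N₂)

{-# OPTIONS --safe #-}

-- Give every location one extra place, marked once, and let each transition
-- borrow the token of its location while it fires.  This makes each location a
-- sequential component, all ordinary places being interface.  The extra tokens
-- never disable anything: if a transition t is enabled while u is running, then
-- postponing u gives a reachable marking enabling t and u together, so that t
-- and u are at different locations.  Hence forgetting the extra places is a
-- (strong) bisimulation between the reachable ST-markings.

module Submission where

open import Defs
open import Level using (Level)
open import Axiom.ExcludedMiddle using (ExcludedMiddle)
open import Data.Bool using (if_then_else_)
open import Data.Empty using (⊥-elim)
open import Data.Empty.Polymorphic using (⊥)
open import Data.Fin using (zero; suc)
open import Data.List using (List; []; _∷_; _∷ʳ_; map; lookup; removeAt)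
open import Data.List.Properties using (map-++)
open import Data.List.Relation.Unary.All using ([]; _∷_)
open import Data.List.Relation.Unary.Any using (here)
open import Data.List.Relation.Unary.AllPairs using ([]; _∷_)
open import Data.Nat using (ℕ; zero; suc; _+_; _*_; _∸_; _≤_; z≤n; s≤s)
open import Data.Nat.ListAction using (sum)
open import Data.Nat.ListAction.Properties using (sum-++)
open import Data.Nat.Properties
open import Data.Product using (Σ; ∃; _×_; _,_; proj₁; proj₂)
open import Data.Sum using (_⊎_; inj₁; inj₂; [_,_]) renaming (map to ⊎-map)
open import Data.Unit.Polymorphic using (⊤; tt)
open import Function using (_∘_; flip; const)
open import Relation.Binary.Construct.Closure.ReflexiveTransitive using (ε)
open import Relation.Binary.PropositionalEquality using
  (_≡_; _≢_; _≗_; refl; sym; trans; cong; cong₂; subst; module ≡-Reasoning)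
open import Relation.Nullary using (Dec; yes; no; does)
open import Relation.Unary using (Pred; ⋃; _∖_)

-- Sums over lists with one entry appended or removed.

sum-map-∷ʳ : ∀ {a} {A : Set a} (f : A → ℕ) xs x →
  sum (map f (xs ∷ʳ x)) ≡ f x + sum (map f xs)
sum-map-∷ʳ f xs x = begin
  sum (map f (xs ∷ʳ x))        ≡⟨ cong sum (map-++ f xs (x ∷ [])) ⟩
  sum (map f xs ∷ʳ f x)        ≡⟨ sum-++ (map f xs) (f x ∷ []) ⟩
  sum (map f xs) + (f x + 0)   ≡⟨ cong (sum (map f xs) +_) (+-identityʳ (f x)) ⟩
  sum (map f xs) + f x         ≡⟨ +-comm (sum (map f xs)) (f x) ⟩
  f x + sum (map f xs)         ∎
  where open ≡-Reasoning

sum-map-removeAt : ∀ {a} {A : Set a} (f : A → ℕ) xs i →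
  sum (map f xs) ≡ f (lookup xs i) + sum (map f (removeAt xs i))
sum-map-removeAt f (x ∷ xs) zero = refl
sum-map-removeAt f (x ∷ xs@(_ ∷ _)) (suc i) = begin
  f x + sum (map f xs)                       ≡⟨ cong (f x +_) (sum-map-removeAt f xs i) ⟩
  f x + (f (lookup xs i) + rest)             ≡⟨ +-assoc (f x) _ rest ⟨
  f x + f (lookup xs i) + rest               ≡⟨ cong (_+ rest) (+-comm (f x) _) ⟩
  f (lookup xs i) + f x + rest               ≡⟨ +-assoc _ (f x) rest ⟩
  f (lookup xs i) + (f x + rest)             ∎
  where
  open ≡-Reasoning
  rest = sum (map f (removeAt xs i))

-- ST-markings with their running transitions postponed.

module _ {ℓ} {Act : Set ℓ} (N : Net Act) where
  open Net N

  -- The marking in which the transitions that are running have not yet started.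
  postponed : STMarking N → Marking
  postponed (M , V) s = M s + sum (map (λ t → pre t s) V)

  -- `⟅ t ⟆` is a one-element list, so `pre⁺` and `post⁺` end in `+ 0`; this and the next three
  -- lemmas absorb it.
  enabled⇒pre≤ : ∀ {M t} → M [ ⟅ t ⟆ ⟩ → pre t ≤ᴹ M
  enabled⇒pre≤ (_ , le , _) s = ≤-trans (m≤m+n _ 0) (le s)

  pre≤⇒enabled : ∀ {M t} → pre t ≤ᴹ M → M [ ⟅ t ⟆ ⟩
  pre≤⇒enabled {M} {t} le =
    _ , (λ s → ≤-trans (≤-reflexive (+-identityʳ (pre t s))) (le s)) , λ _ → refl

  fires⇒≗ : ∀ {M t M′} → M [ ⟅ t ⟆ ⟩ M′ → M′ ≗ (M -ᴹ pre t) +ᴹ post t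
  fires⇒≗ {M} {t} (_ , eq) s = trans (eq s)
    (cong₂ (λ a b → M s ∸ a + b) (+-identityʳ (pre t s)) (+-identityʳ (post t s)))

  ≗⇒fires : ∀ {M t M′} → pre t ≤ᴹ M → M′ ≗ (M -ᴹ pre t) +ᴹ post t → M [ ⟅ t ⟆ ⟩ M′
  ≗⇒fires {M} {t} le eq =
    (λ s → ≤-trans (≤-reflexive (+-identityʳ (pre t s))) (le s)) ,
    λ s → trans (eq s) (sym
      (cong₂ (λ a b → M s ∸ a + b) (+-identityʳ (pre t s)) (+-identityʳ (post t s))))

  -- Starting `t` only moves `pre t` from the marking into the sum over running transitions. Ending
  -- `t` withdraws `pre t` from that sum and adds `post t`, which is a complete firing of `t`. A
  -- silent step fires next to the tokens of that sum.
  postponed-step : ∀ {p α p′} → STStep N p α p′ →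
    postponed p′ ≗ postponed p ⊎ ∃ λ t → postponed p [ ⟅ t ⟆ ⟩ postponed p′
  postponed-step {M , V} {τ} {M′ , _} ((t , _ , fires) , refl) =
    inj₂ (t , ≗⇒fires (λ s → m≤n⇒m≤n+o _ (le s)) eq)
    where
    le = enabled⇒pre≤ (M′ , fires)
    eq : postponed (M′ , V) ≗ (postponed (M , V) -ᴹ pre t) +ᴹ post t
    eq s = begin
      M′ s + v                     ≡⟨ cong (_+ v) (fires⇒≗ fires s) ⟩
      M s ∸ pre t s + post t s + v ≡⟨ +-assoc (M s ∸ pre t s) _ v ⟩
      M s ∸ pre t s + (post t s + v) ≡⟨ cong (M s ∸ pre t s +_) (+-comm _ v) ⟩
      M s ∸ pre t s + (v + post t s) ≡⟨ +-assoc (M s ∸ pre t s) v _ ⟨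
      M s ∸ pre t s + v + post t s ≡⟨ cong (_+ post t s) (+-∸-comm v (le s)) ⟨
      M s + v ∸ pre t s + post t s ∎
      where
      open ≡-Reasoning
      v = sum (map (λ u → pre u s) V)
  postponed-step {M , V} {vis (a ⁺)} {M′ , _} (t , _ , en , M≗ , refl) = inj₁ λ s →
    let v = sum (map (λ u → pre u s) V) in begin
      M′ s + sum (map (λ u → pre u s) (V ∷ʳ t))
        ≡⟨ cong₂ _+_ (M≗ s) (sum-map-∷ʳ (λ u → pre u s) V t) ⟩
      M s ∸ pre t s + (pre t s + v) ≡⟨ +-assoc (M s ∸ pre t s) _ v ⟨
      M s ∸ pre t s + pre t s + v   ≡⟨ cong (_+ v) (m∸n+n≡m (enabled⇒pre≤ en s)) ⟩
      M s + v                       ∎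
    where open ≡-Reasoning
  postponed-step {M , V} {vis (a ⁻[1+ n ])} {M′ , _} (i , _ , _ , refl , M≗) =
    inj₂ (t , ≗⇒fires le eq)
    where
    t = lookup V i
    before : ∀ s → postponed (M , V) s ≡ pre t s + (M s + sum (map (λ u → pre u s) (removeAt V i)))
    before s = begin
      M s + sum (map (λ u → pre u s) V) ≡⟨ cong (M s +_) (sum-map-removeAt (λ u → pre u s) V i) ⟩
      M s + (pre t s + v)               ≡⟨ +-assoc (M s) _ v ⟨
      M s + pre t s + v                 ≡⟨ cong (_+ v) (+-comm (M s) _) ⟩
      pre t s + M s + v                 ≡⟨ +-assoc (pre t s) (M s) v ⟩
      pre t s + (M s + v)               ∎
      where
      open ≡-Reasoning
      v = sum (map (λ u → pre u s) (removeAt V i))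
    le : pre t ≤ᴹ postponed (M , V)
    le s = ≤-trans (m≤m+n _ _) (≤-reflexive (sym (before s)))
    eq : postponed (M′ , removeAt V i) ≗ (postponed (M , V) -ᴹ pre t) +ᴹ post t
    eq s = begin
      M′ s + v               ≡⟨ cong (_+ v) (M≗ s) ⟩
      M s + post t s + v     ≡⟨ +-assoc (M s) _ v ⟩
      M s + (post t s + v)   ≡⟨ cong (M s +_) (+-comm _ v) ⟩
      M s + (v + post t s)   ≡⟨ +-assoc (M s) v _ ⟨
      M s + v + post t s     ≡⟨ cong (_+ post t s) (m+n∸m≡n (pre t s) (M s + v)) ⟨
      pre t s + (M s + v) ∸ pre t s + post t s
        ≡⟨ cong (λ x → x ∸ pre t s + post t s) (before s) ⟨
      postponed (M , V) s ∸ pre t s + post t s ∎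
      where
      open ≡-Reasoning
      v = sum (map (λ u → pre u s) (removeAt V i))

  -- Markings are compared pointwise, and `postponed` turns the initial one into `M₀ s + 0`; so a
  -- reachable `R` with the same values is asked for.
  ReachablePostponed : STMarking N → Set ℓ
  ReachablePostponed p = ∃ λ R → Reachable R × R ≗ postponed p

  reachablePostponed-step : ∀ {p α p′} → ReachablePostponed p → STStep N p α p′ →
    ReachablePostponed p′
  reachablePostponed-step {p} {p′ = p′} (R , reach , R≗) st
    with postponed-step {p} {p′ = p′} st
  ... | inj₁ eq = R , reach , λ s → trans (R≗ s) (sym (eq s))
  -- `step` admits every marking with the right values, so `postponed p′` is itself reachable here.
  ... | inj₂ (t , fires) = postponed p′ , step {G = ⟅ t ⟆} reach
    (≗⇒fires (λ s → ≤-trans (enabled⇒pre≤ (_ , fires) s) (≤-reflexive (sym (R≗ s))))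
             (λ s → trans (fires⇒≗ fires s)
                          (cong (λ x → x ∸ pre t s + post t s) (sym (R≗ s))))) ,
    λ _ → refl

-- The net with location places and its sequential components.

module Construction {ℓ} (em : ExcludedMiddle ℓ) {Act : Set ℓ} (N : Net Act)
         {Loc : Set ℓ} (D : Net.S N ⊎ Net.T N → Loc)
         (local : ∀ s t → s ∈ᴹ Net.pre N t → D (inj₂ t) ≡ D (inj₁ s))
         (separate : ∀ t u → Net._⌣_ N t u → D (inj₂ t) ≢ D (inj₂ u)) where
  open Net N

  -- The Kronecker delta; excluded middle decides equality of locations.
  δ : Loc → Loc → ℕ
  δ k l = if does (em {k ≡ l}) then 1 else 0

  δ-refl : ∀ k → δ k k ≡ 1
  δ-refl k with em {k ≡ k}
  ... | yes _ = refl
  ... | no k≢k = ⊥-elim (k≢k refl)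

  δ-≢ : ∀ {k l} → k ≢ l → δ k l ≡ 0
  δ-≢ {k} {l} k≢l with em {k ≡ l}
  ... | yes k≡l = ⊥-elim (k≢l k≡l)
  ... | no _ = refl

  δ-≡ : ∀ {k l} → δ k l ≢ 0 → k ≡ l
  δ-≡ {k} {l} ne with em {k ≡ l}
  ... | yes k≡l = k≡l
  ... | no _ = ⊥-elim (ne refl)

  guarded-F : ((S ⊎ Loc) × T) ⊎ (T × (S ⊎ Loc)) → ℕ
  guarded-F (inj₁ (inj₁ s , t)) = pre t s
  guarded-F (inj₁ (inj₂ k , t)) = δ (D (inj₂ t)) k
  guarded-F (inj₂ (t , inj₁ s)) = post t s
  guarded-F (inj₂ (t , inj₂ k)) = δ (D (inj₂ t)) k

  guarded : Net Act
  guarded = record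
    { S = S ⊎ Loc ; T = T ; F = guarded-F ; M₀ = [ M₀ , const 1 ] ; label = label }

  private module G = Net guarded

  component-F : ∀ k → let Tₖ = Σ T λ t → D (inj₂ t) ≡ k in
    ((S ⊎ ⊤ {ℓ}) × Tₖ) ⊎ (Tₖ × (S ⊎ ⊤ {ℓ})) → ℕ
  component-F k (inj₁ (inj₁ s , t , _)) = pre t s
  component-F k (inj₁ (inj₂ _ , _)) = 1
  component-F k (inj₂ ((t , _) , inj₁ s)) = post t s
  component-F k (inj₂ (_ , inj₂ _)) = 1

  -- Every component contains all ordinary places: those at `k` as inputs, the others as outputs.
  -- The factor `δ` gives the initial tokens of a place only to the component at its own location,
  -- so that they are counted once in the composition.
  component : Loc → Component Act
  component k = record
    { net = record
      { S = S ⊎ ⊤ {ℓ}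
      ; T = Σ T λ t → D (inj₂ t) ≡ k
      ; F = component-F k
      ; M₀ = [ (λ s → δ (D (inj₁ s)) k * M₀ s) , const 1 ]
      ; label = label ∘ proj₁
      }
    ; I = [ (λ s → D (inj₁ s) ≡ k) , const ⊥ ]
    ; O = [ (λ s → D (inj₁ s) ≢ k) , const ⊥ ]
    ; I∩O=∅ = λ { (inj₁ s) (i , o) → o i }
    ; outputs-end = λ { (inj₁ s) o (t , Dt≡k) → no-output s o t Dt≡k }
    }
    where
    no-output : ∀ s → D (inj₁ s) ≢ k → ∀ t → D (inj₂ t) ≡ k → pre t s ≡ 0
    no-output s Ds≢k t Dt≡k with pre t s in eq
    ... | zero = refl
    ... | suc _ = ⊥-elim (Ds≢k (trans (sym (local s t λ eq₀ → 1+n≢0 (trans (sym eq) eq₀))) Dt≡k))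

  control : Pred (S ⊎ ⊤ {ℓ}) ℓ
  control = [ const ⊥ , const ⊤ ]

  ∣↾control∣ : (A : Multiset (S ⊎ ⊤ {ℓ})) → A (inj₂ tt) ≡ 1 → ∣ A ↾ control ∣≡ 1
  ∣↾control∣ A eq = inj₂ tt ∷ [] , ([] ∷ []) , (tt ∷ []) ,
    (λ { (inj₂ tt) _ _ → here refl }) , trans (+-identityʳ _) eq

  sequential : ∀ k → Sequential (component k)
  sequential k = control ,
    (λ { {inj₁ _} () ; {inj₂ _} _ (inj₁ ()) ; {inj₂ _} _ (inj₂ ()) }) ,
    (λ t → ∣↾control∣ (C.pre t) refl) , (λ t → ∣↾control∣ (C.post t) refl) ,
    ∣↾control∣ C.M₀ refl
    where module C = Component (component k)

  -- The asynchronous parallel composition.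

  place : Loc → S ⊎ ⊤ {ℓ} → S ⊎ Loc
  place k = ⊎-map (λ s → s) (const k)

  module Comp = Composition component guarded place (λ _ → proj₁)

  ordinary∈interface : ∀ k s → Comp.interface k (inj₁ (inj₁ s))
  ordinary∈interface k s with em {D (inj₁ s) ≡ k}
  ... | yes Ds≡k = inj₁ s , inj₁ (inj₁ s , Ds≡k , refl) , refl
  ... | no  Ds≢k = inj₁ s , inj₂ (inj₁ s , Ds≢k , refl) , refl

  interface⊆elements : ∀ k {e} → Comp.interface k e → Comp.elements k e
  interface⊆elements k (_ , inj₁ (x , _ , refl) , refl) = inj₁ x , refl
  interface⊆elements k (_ , inj₂ (x , _ , refl) , refl) = inj₁ x , refl

  -- Only ordinary places can be shared: a location place and a transition each determine the
  -- component they come from.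
  shared∈interface : ∀ {k l} → k ≢ l → ∀ {e} → Comp.elements k e → Comp.elements l e →
    Comp.interface k e × Comp.interface l e
  shared∈interface {k} {l} k≢l (inj₁ (inj₁ s) , refl) _ =
    ordinary∈interface k s , ordinary∈interface l s
  shared∈interface k≢l (inj₁ (inj₂ _) , refl) (inj₁ (inj₂ _) , refl) = ⊥-elim (k≢l refl)
  shared∈interface k≢l (inj₂ (t , refl) , refl) (inj₂ (.t , refl) , refl) = ⊥-elim (k≢l refl)

  guarded-isComposition :
    Comp.IsComposition (⋃ Loc Comp.inputs) (⋃ Loc Comp.outputs ∖ ⋃ Loc Comp.inputs)
  guarded-isComposition = record
    { element-injective = λ
        { k {inj₁ (inj₁ _)} {inj₁ (inj₁ _)} refl → refl
        ; k {inj₁ (inj₁ _)} {inj₁ (inj₂ _)} ()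
        ; k {inj₁ (inj₂ _)} {inj₁ (inj₁ _)} ()
        ; k {inj₁ (inj₂ _)} {inj₁ (inj₂ _)} _ → refl
        -- The two proofs that the transition lies at `k` agree by uniqueness of identity proofs.
        ; k {inj₂ (_ , refl)} {inj₂ (_ , refl)} refl → refl }
    ; sharing = λ k l k≢l →
        (λ (x , y) → shared∈interface k≢l x y) ,
        λ (x , y) → interface⊆elements k x , interface⊆elements l y
    ; inputs-disjoint = λ
        { k l k≢l _ ((inj₁ s , Ds≡k , refl) , (inj₁ .s , Ds≡l , refl)) →
          k≢l (trans (sym Ds≡k) Ds≡l) }
    ; S=⋃ = λ { (inj₁ s) → D (inj₁ s) , inj₁ s , refl ; (inj₂ k) → k , inj₂ tt , refl }
    ; T=⋃ = λ t → D (inj₂ t) , (t , refl) , refl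
    ; F-inside = λ
        { k (inj₁ (inj₁ _ , _)) → refl
        ; k (inj₁ (inj₂ _ , _ , refl)) → δ-refl k
        ; k (inj₂ (_ , inj₁ _)) → refl
        ; k (inj₂ ((_ , refl) , inj₂ _)) → δ-refl k }
    ; F-outside = λ
        -- A pair of an ordinary place and `t` always lies in the component of `t`. Only pairs of
        -- `t` with a foreign location place are outside, and there `δ` vanishes.
        { (inj₁ (inj₁ s , t)) out → ⊥-elim (out _ (inj₁ (inj₁ s , t , refl)) refl)
        ; (inj₁ (inj₂ k , t)) out → δ-≢ λ eq → out k (inj₁ (inj₂ tt , t , eq)) refl
        ; (inj₂ (t , inj₁ s)) out → ⊥-elim (out _ (inj₂ ((t , refl) , inj₁ s)) refl)
        ; (inj₂ (t , inj₂ k)) out → δ-≢ λ eq → out k (inj₂ ((t , eq) , inj₂ tt)) refl }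
    ; M₀=Σ = λ
        -- The copy of `s` at its own location is the only one that can be marked, so a one-element
        -- enumeration suffices.
        { (inj₁ s) → (D (inj₁ s) , inj₁ s) ∷ [] , ([] ∷ []) , (refl ∷ []) ,
            (λ { (k , inj₁ .s) refl ne →
              here (cong (_, inj₁ s) (sym (δ-≡ (λ eq → ne (cong (_* M₀ s) eq))))) }) ,
            trans (+-identityʳ _) (trans (cong (_* M₀ s) (δ-refl (D (inj₁ s)))) (*-identityˡ (M₀ s)))
        ; (inj₂ k) → (k , inj₂ tt) ∷ [] , ([] ∷ []) , (refl ∷ []) ,
            (λ { (.k , inj₂ _) refl _ → here refl }) , refl }
    ; label=⋃ = λ _ _ → refl
    ; I=⋃ = (λ x → x) , λ x → x
    ; O=⋃ = (λ x → x) , λ x → x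
    }

  guarded-LSGA : LSGA guarded
  guarded-LSGA = _ , _ , Loc , component , sequential , place , (λ _ → proj₁) , guarded-isComposition

  -- At most one running transition per location.

  running-at : Loc → List T → ℕ
  running-at k V = sum (map (λ t → δ (D (inj₂ t)) k) V)

  running-at-∷≤1 : ∀ {R} → Reachable R → ∀ t V →
    (∀ s → sum (map (λ u → pre u s) (t ∷ V)) ≤ R s) → ∀ k → running-at k (t ∷ V) ≤ 1
  running-at-∷≤1 reach t [] le k with em {D (inj₂ t) ≡ k}
  ... | yes _ = s≤s z≤n
  ... | no _ = z≤n
  running-at-∷≤1 {R} reach t (u ∷ V) le k = separated em
    (running-at-∷≤1 reach t V
      (λ s → ≤-trans (+-monoʳ-≤ (pre t s) (m≤n+m _ (pre u s))) (le s)) k)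
    (running-at-∷≤1 reach u V (λ s → ≤-trans (m≤n+m _ (pre t s)) (le s)) k)
    where
    t⌣u : t ⌣ u
    t⌣u = R , reach , _ ,
      (λ s → ≤-trans (+-monoʳ-≤ (pre t s) (+-monoʳ-≤ (pre u s) z≤n)) (le s)) , λ _ → refl
    separated : Dec (D (inj₂ t) ≡ k) → running-at k (t ∷ V) ≤ 1 → running-at k (u ∷ V) ≤ 1 →
      running-at k (t ∷ u ∷ V) ≤ 1
    separated (no Dt≢k) _ ≤1 rewrite δ-≢ Dt≢k = ≤1
    separated (yes Dt≡k) ≤1 _
      rewrite δ-≢ (λ Du≡k → separate t u t⌣u (trans Dt≡k (sym Du≡k))) = ≤1

  running-at≤1 : ∀ {R} → Reachable R → ∀ V → (∀ s → sum (map (λ t → pre t s) V) ≤ R s) →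
    ∀ k → running-at k V ≤ 1
  running-at≤1 reach [] le k = z≤n
  running-at≤1 reach (t ∷ V) = running-at-∷≤1 reach t V

  -- The bisimulation and its invariants.

  Similar : STMarking guarded → STMarking N → Set ℓ
  Similar (M , V) (M₁ , V₁) = (∀ s → M (inj₁ s) ≡ M₁ s) × V ≡ V₁

  -- The left side is `postponed guarded p` at the place `inj₂ k`: the token of `k` is either
  -- present or borrowed.
  TokensConserved : STMarking guarded → Set ℓ
  TokensConserved (M , V) = ∀ k → M (inj₂ k) + running-at k V ≡ 1

  -- The first invariant fixes the location places in terms of the running transitions; the second
  -- makes `separate` applicable to these.
  B : STMarking guarded → STMarking N → Set ℓ
  B p q = Similar p q × TokensConserved p × ReachablePostponed N q

  -- A transition takes from and returns to a location place the same number of tokens, so complete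
  -- firings in the postponed marking leave that place unchanged.
  tokensConserved-step : ∀ {p α p′} → TokensConserved p → STStep guarded p α p′ → TokensConserved p′
  tokensConserved-step {p} {p′ = p′} tok st k with postponed-step guarded {p} {p′ = p′} st
  ... | inj₁ eq = trans (eq (inj₂ k)) (tok k)
  ... | inj₂ (t , fires) = trans (fires⇒≗ guarded fires (inj₂ k))
    (trans (m∸n+n≡m (enabled⇒pre≤ guarded (_ , fires) (inj₂ k))) (tok k))

  -- Transfer of steps between the two nets.

  project : ∀ {p q p′ q′} α → Similar p q → Similar p′ q′ →
    STStep guarded p α p′ → STStep N q α q′
  project τ (m , refl) (m′ , refl) ((t , lab , fires) , refl) =
    (t , lab , ≗⇒fires N
      (λ s → subst (pre t s ≤_) (m s) (enabled⇒pre≤ guarded (_ , fires) (inj₁ s)))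
      (λ s → trans (sym (m′ s)) (trans (fires⇒≗ guarded fires (inj₁ s))
               (cong (λ x → x ∸ pre t s + post t s) (m s))))) , refl
  project (vis (a ⁺)) (m , refl) (m′ , refl) (t , lab , en , eq , refl) =
    t , lab ,
    pre≤⇒enabled N (λ s → subst (pre t s ≤_) (m s) (enabled⇒pre≤ guarded en (inj₁ s))) ,
    (λ s → trans (sym (m′ s)) (trans (eq (inj₁ s)) (cong (_∸ pre t s) (m s)))) , refl
  project (vis (a ⁻[1+ n ])) (m , refl) (m′ , refl) (i , i≡n , lab , refl , eq) =
    i , i≡n , lab , refl ,
    λ s → trans (sym (m′ s)) (trans (eq (inj₁ s)) (cong (_+ _) (m s)))

  -- If `t` is enabled beside the running `V`, the postponed marking covers `t ∷ V`, so at most one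
  -- of these is at `k`. As the free and borrowed tokens of `k` sum to 1, cancelling the borrowed
  -- ones leaves what `t` needs.
  lift-enabled : ∀ {p q t} → B p q → pre t ≤ᴹ proj₁ q → G.pre t ≤ᴹ proj₁ p
  lift-enabled {t = t} ((m , refl) , _) le (inj₁ s) = subst (pre t s ≤_) (sym (m s)) (le s)
  lift-enabled {p = M , V} {t = t} ((m , refl) , tok , R , reach , R≗) le (inj₂ k) =
    +-cancelʳ-≤ (running-at k V) _ _
      (≤-trans (running-at-∷≤1 reach t V
                 (λ s → ≤-trans (+-monoˡ-≤ _ (le s)) (≤-reflexive (sym (R≗ s)))) k)
               (≤-reflexive (sym (tok k))))

  -- On location places the target values are forced: both conservation equations have right side 1,
  -- and cancelling the transitions that run before and after gives the required change.
  lift : ∀ {p q p′ q′} α → B p q → B p′ q′ → STStep N q α q′ → STStep guarded p α p′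
  lift {M , V} {p′ = M′ , _} τ b@((m , refl) , tok , _) ((m′ , refl) , tok′ , _)
      ((t , lab , fires) , refl) =
    (t , lab , ≗⇒fires guarded le λ
      { (inj₁ s) → trans (m′ s) (trans (fires⇒≗ N fires s)
                     (cong (λ x → x ∸ pre t s + post t s) (sym (m s))))
      ; (inj₂ k) → trans (+-cancelʳ-≡ (running-at k V) _ _ (trans (tok′ k) (sym (tok k))))
                     (sym (m∸n+n≡m (le (inj₂ k)))) }) , refl
    where le = lift-enabled b (enabled⇒pre≤ N (_ , fires))
  lift {M , V} {p′ = M′ , _} (vis (a ⁺)) b@((m , refl) , tok , _) ((m′ , refl) , tok′ , _)
      (t , lab , en , eq , refl) =
    t , lab , pre≤⇒enabled guarded (lift-enabled b (enabled⇒pre≤ N en)) ,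
    (λ { (inj₁ s) → trans (m′ s) (trans (eq s) (cong (_∸ pre t s) (sym (m s))))
       ; (inj₂ k) → token k }) , refl
    where
    open ≡-Reasoning
    token : ∀ k → M′ (inj₂ k) ≡ M (inj₂ k) ∸ δ (D (inj₂ t)) k
    token k = trans (sym (m+n∸n≡m (M′ (inj₂ k)) d)) (cong (_∸ d) (+-cancelʳ-≡ c _ _ (begin
      M′ (inj₂ k) + d + c   ≡⟨ +-assoc (M′ (inj₂ k)) d c ⟩
      M′ (inj₂ k) + (d + c) ≡⟨ cong (M′ (inj₂ k) +_) (sum-map-∷ʳ (λ u → δ (D (inj₂ u)) k) V t) ⟨
      M′ (inj₂ k) + running-at k (V ∷ʳ t) ≡⟨ trans (tok′ k) (sym (tok k)) ⟩
      M (inj₂ k) + c        ∎)))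
      where
      d = δ (D (inj₂ t)) k
      c = running-at k V
  lift {M , V} {p′ = M′ , _} (vis (a ⁻[1+ n ])) ((m , refl) , tok , _) ((m′ , refl) , tok′ , _)
      (i , i≡n , lab , refl , eq) =
    i , i≡n , lab , refl ,
    λ { (inj₁ s) → trans (m′ s) (trans (eq s) (cong (_+ _) (sym (m s))))
      ; (inj₂ k) → token k }
    where
    open ≡-Reasoning
    token : ∀ k → M′ (inj₂ k) ≡ M (inj₂ k) + δ (D (inj₂ (lookup V i))) k
    token k = +-cancelʳ-≡ c _ _ (begin
      M′ (inj₂ k) + c              ≡⟨ trans (tok′ k) (sym (tok k)) ⟩
      M (inj₂ k) + running-at k V  ≡⟨ cong (M (inj₂ k) +_) (sum-map-removeAt (λ u → δ (D (inj₂ u)) k) V i) ⟩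
      M (inj₂ k) + (d + c)         ≡⟨ +-assoc (M (inj₂ k)) d c ⟨
      M (inj₂ k) + d + c           ∎)
      where
      d = δ (D (inj₂ (lookup V i))) k
      c = running-at k (removeAt V i)

  -- The only values on location places that `TokensConserved` permits; the truncated subtraction is
  -- exact by `running-at≤1`.
  lifted : STMarking N → STMarking guarded
  lifted (M , V) = [ M , (λ k → 1 ∸ running-at k V) ] , V

  B-lifted : ∀ {q} → ReachablePostponed N q → B (lifted q) q
  B-lifted {M , V} r@(R , reach , R≗) = ((λ _ → refl) , refl) ,
    (λ k → m∸n+n≡m (running-at≤1 reach V
      (λ s → ≤-trans (m≤n+m _ (M s)) (≤-reflexive (sym (R≗ s)))) k)) , r

  guarded≈ : guarded ≈ᵇˢᵀᵇ N
  guarded≈ = B , record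
    { starts = ((λ _ → refl) , refl) , (λ _ → refl) , M₀ , initial , λ s → sym (+-identityʳ (M₀ s))
    ; forward = forward
    ; backward = backward
    } ,
    -- `ps 0` and `ps 1` are both related to `q`, so the silent step between them projects to a
    -- silent loop at `q`, repeated forever by the constant path.
    (λ { {q = q} b (refl , path) all → const q , (refl , λ _ →
           project τ (proj₁ (all 0)) (proj₁ (all 1)) (path 0)) , λ k _ → all k }) ,
    (λ { {q = p} b (refl , path) all → const p , (refl , λ _ →
           lift τ (all 0) (all 1) (path 0)) , λ k _ → all k })
    where
    forward : Transfer (ST-LTS guarded) (ST-LTS N) B
    forward {p} {q} {α} {M′ , V′} b@(sim , tok , reach) st =
      q , q′ , ε , inj₁ st′ , b ,
      sim′ , tokensConserved-step {p} {α} tok st , reachablePostponed-step N {q} {α} reach st′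
      where
      q′ : STMarking N
      q′ = M′ ∘ inj₁ , V′
      sim′ : Similar (M′ , V′) q′
      sim′ = (λ _ → refl) , refl
      st′ = project {p} {q} {M′ , V′} {q′} α sim sim′ st
    backward : Transfer (ST-LTS N) (ST-LTS guarded) (flip B)
    backward {q} {p} {α} {q′} b@(_ , _ , reach) st =
      p , lifted q′ , ε , inj₁ (lift α b b′ st) , b , b′
      where b′ = B-lifted (reachablePostponed-step N {q} {α} reach st)

theorem1 : {ℓ : Level} → ExcludedMiddle ℓ → {Act : Set ℓ} (N : Net Act) → Distributed N → Σ (Net Act) (λ N′ → LSGA N′ × (N′ ≈ᵇˢᵀᵇ N))
theorem1 em N (Loc , D , local , separate) = guarded , guarded-LSGA , guarded≈
  where open Construction em N D local separate
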